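{- The cut rule is admissible: every sequent derivable using the rules (id), ($\land$), ($\lor$), ($\Box$), ($\Diamond$) and (cut) is derivable using only (id), ($\land$), ($\lor$), ($\Box$), ($\Diamond$).
   Context: Fix a countable set of atoms; each atom $\alpha$ has a dual negative atom $\alpha^\perp$. Formulas: $A,B ::= \alpha \mid \alpha^\perp \mid A\land B \mid A\lor B \mid \Box A \mid \Diamond A$. Negation $A^\perp$: $(\alpha)^\perp=\alpha^\perp$, $(\alpha^\perp)^\perp=\alpha$, $(A\land B)^\perp=A^\perp\lor B^\perp$, $(A\lor B)^\perp=A^\perp\land B^\perp$, $(\Box A)^\perp=\Diamond A^\perp$, $(\Diamond A)^\perp=\Box A^\perp$. A (nested) sequent is given by $\Gamma,\Delta ::= \cdot \mid \Gamma, A \mid \Gamma, [\Delta]$, where $\cdot$ is the empty sequent; sequents are taken up to exchange, and $\Gamma,\Delta$ denotes juxtaposition. A unary context is given by $\Gamma\{ -\} ::= \Delta,\{ -\} \mid \Delta,[\Gamma\{ -\}]$; $\Gamma\{\Delta\}$ is the result of filling the hole with $\Delta$, and $\Gamma\{\}$ means $\Gamma\{\cdot\}$. Depth: $\mathrm{depth}(\Delta,\{ -\})=0$, $\mathrm{depth}(\Delta,[\Gamma\{ -\}])=\mathrm{depth}(\Gamma\{ -\})+1$. Rules: (id) $\Gamma\{\alpha^\perp,\alpha\}$ with no premises ($\alpha$ an atom); ($\land$) from $\Gamma\{A\}$ and $\Gamma\{B\}$ infer $\Gamma\{A\land B\}$; ($\lor$) from $\Gamma\{A,B\}$ infer $\Gamma\{A\lor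 B\}$; ($\Box$) from $\Gamma\{[\Diamond A^\perp, A]\}$ infer $\Gamma\{\Box A\}$; ($\Diamond$) from $\Gamma\{\Delta\{A\},\Diamond A\}$ infer $\Gamma\{\Delta\{\},\Diamond A\}$, provided $\mathrm{depth}(\Delta\{ -\})>0$; (cut) from $\Gamma\{A\}$ and $\Gamma\{A^\perp\}$ infer $\Gamma\{\}$. -}

module Defs where

open import Data.Nat using (ℕ; zero; suc; _>_)

infix  30 _^⊥
infixr 25 □_ ◇_
infixr 22 _∧_
infixr 21 _∨_
infixl 15 _▸_ _▸[_] _▸▸_
infix  14 _▸｛-｝ _▸[_]ᶜ
infix  10 _≈_ _⊢_

data Formula (Atom : Set) : Set where
  pos neg : Atom → Formula Atom
  _∧_ _∨_ : Formula Atom → Formula Atom → Formula Atom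
  □_ ◇_   : Formula Atom → Formula Atom

_^⊥ : ∀ {Atom} → Formula Atom → Formula Atom
(pos α) ^⊥ = neg α
(neg α) ^⊥ = pos α
(A ∧ B) ^⊥ = (A ^⊥) ∨ (B ^⊥)
(A ∨ B) ^⊥ = (A ^⊥) ∧ (B ^⊥)
(□ A)   ^⊥ = ◇ (A ^⊥)
(◇ A)   ^⊥ = □ (A ^⊥)

-- Γ ▸ A is "Γ , A" and Γ ▸[ Δ ] is "Γ , [Δ]".
data Sequent (Atom : Set) : Set where
  ∅     : Sequent Atom
  _▸_   : Sequent Atom → Formula Atom → Sequent Atom
  _▸[_] : Sequent Atom → Sequent Atom → Sequent Atom

-- Juxtaposition "Γ , Δ".
_▸▸_ : ∀ {Atom} → Sequent Atom → Sequent Atom → Sequent Atom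
Γ ▸▸ ∅          = Γ
Γ ▸▸ (Δ ▸ A)    = (Γ ▸▸ Δ) ▸ A
Γ ▸▸ (Δ ▸[ Σ ]) = (Γ ▸▸ Δ) ▸[ Σ ]

-- Equality of sequents up to exchange, at every nesting level.
data _≈_ {Atom : Set} : Sequent Atom → Sequent Atom → Set where
  ≈-refl  : ∀ {Γ} → Γ ≈ Γ
  ≈-sym   : ∀ {Γ Δ} → Γ ≈ Δ → Δ ≈ Γ
  ≈-trans : ∀ {Γ Δ Σ} → Γ ≈ Δ → Δ ≈ Σ → Γ ≈ Σ
  ▸-cong  : ∀ {Γ Γ′ A} → Γ ≈ Γ′ → Γ ▸ A ≈ Γ′ ▸ A
  ▸[]-cong : ∀ {Γ Γ′ Δ Δ′} → Γ ≈ Γ′ → Δ ≈ Δ′ → Γ ▸[ Δ ] ≈ Γ′ ▸[ Δ′ ]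
  swap-ff : ∀ {Γ A B} → Γ ▸ A ▸ B ≈ Γ ▸ B ▸ A
  swap-fb : ∀ {Γ A Δ} → Γ ▸ A ▸[ Δ ] ≈ Γ ▸[ Δ ] ▸ A
  swap-bb : ∀ {Γ Δ Σ} → Γ ▸[ Δ ] ▸[ Σ ] ≈ Γ ▸[ Σ ] ▸[ Δ ]

data Context (Atom : Set) : Set where
  _▸｛-｝ : Sequent Atom → Context Atom
  _▸[_]ᶜ : Sequent Atom → Context Atom → Context Atom

-- Γ ⟨ Δ ⟩ is "Γ{Δ}".
infix 16 _⟨_⟩
_⟨_⟩ : ∀ {Atom} → Context Atom → Sequent Atom → Sequent Atom
(Δ ▸｛-｝)    ⟨ Σ ⟩ = Δ ▸▸ Σ
(Δ ▸[ Γ ]ᶜ)  ⟨ Σ ⟩ = Δ ▸[ Γ ⟨ Σ ⟩ ]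

depth : ∀ {Atom} → Context Atom → ℕ
depth (Δ ▸｛-｝)   = zero
depth (Δ ▸[ Γ ]ᶜ) = suc (depth Γ)

data System : Set where
  cut-free with-cut : System

-- The rule exch only renders the convention that sequents are taken up to
-- exchange; it is present in both systems.
data _⊢_ {Atom : Set} : System → Sequent Atom → Set where
  exch : ∀ {s Γ Δ} → Γ ≈ Δ → s ⊢ Γ → s ⊢ Δ
  id   : ∀ {s} (Γ : Context Atom) (α : Atom) →
         s ⊢ Γ ⟨ ∅ ▸ neg α ▸ pos α ⟩
  ∧-rule : ∀ {s} (Γ : Context Atom) (A B : Formula Atom) →
         s ⊢ Γ ⟨ ∅ ▸ A ⟩ →
         s ⊢ Γ ⟨ ∅ ▸ B ⟩ →
         s ⊢ Γ ⟨ ∅ ▸ A ∧ B ⟩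
  ∨-rule : ∀ {s} (Γ : Context Atom) (A B : Formula Atom) →
         s ⊢ Γ ⟨ ∅ ▸ A ▸ B ⟩ →
         s ⊢ Γ ⟨ ∅ ▸ A ∨ B ⟩
  □-rule : ∀ {s} (Γ : Context Atom) (A : Formula Atom) →
         s ⊢ Γ ⟨ ∅ ▸[ ∅ ▸ ◇ (A ^⊥) ▸ A ] ⟩ →
         s ⊢ Γ ⟨ ∅ ▸ □ A ⟩
  ◇-rule : ∀ {s} (Γ Δ : Context Atom) (A : Formula Atom) →
         depth Δ > 0 →
         s ⊢ Γ ⟨ Δ ⟨ ∅ ▸ A ⟩ ▸ ◇ A ⟩ →
         s ⊢ Γ ⟨ Δ ⟨ ∅ ⟩ ▸ ◇ A ⟩
  cut  : ∀ (Γ : Context Atom) (A : Formula Atom) →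
         with-cut ⊢ Γ ⟨ ∅ ▸ A ⟩ →
         with-cut ⊢ Γ ⟨ ∅ ▸ A ^⊥ ⟩ →
         with-cut ⊢ Γ ⟨ ∅ ⟩

{-# OPTIONS --safe #-}

-- Cut-free proof search either succeeds or yields a finite tree (transitive,
-- conversely well-founded) countermodel; the rules including cut are sound for
-- such models, so a sequent derivable with cut has no countermodel and the search
-- must have found a cut-free derivation.  Every ◇A above a node is used to add A
-- to that node, all other logical rules are invertible, and the search terminates
-- because □B is expanded at most once on a branch: the expansion leaves ◇B^⊥
-- behind, and below ◇B^⊥ any sequent containing □B is derivable outright.
module Submission where

open import Data.Nat using (ℕ; zero; suc; _>_; s≤s; z≤n)
open import Data.Nat.Properties using (eq?; suc-injective)
open import Data.Bool using (Bool; true; false)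
open import Data.Empty using (⊥; ⊥-elim)
open import Data.List using (List; []; _∷_; _++_; [_]; length; concatMap)
open import Data.List.Membership.Propositional using (_∈_)
open import Data.List.Membership.Propositional.Properties using (∈-++⁺ˡ; ∈-++⁺ʳ; ∈-++⁻; ∈-concatMap⁺; ∈-concatMap⁻)
open import Data.List.Properties using (++-identityʳ)
open import Data.List.Relation.Binary.Subset.Propositional using (_⊆_)
open import Data.List.Relation.Unary.All as All using (All; []; _∷_)
open import Data.List.Relation.Unary.All.Properties using (++⁻ˡ; ++⁻ʳ)
open import Data.List.Relation.Unary.Any as Any using (here; there)
open import Data.Product using (∃; _×_; _,_; proj₁; proj₂; swap)
open import Data.Sum as Sum using (_⊎_; inj₁; inj₂; [_,_]′)
open import Function.Base using (_∘_)
open import Function.Bundles using (_↣_)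
open import Relation.Binary.Definitions using (DecidableEquality)
open import Relation.Binary.PropositionalEquality using (_≡_; refl; sym; trans; cong; cong₂; subst)
open import Relation.Nullary using (¬_; Dec; yes; no; does)
open import Relation.Nullary.Decidable using (map′; dec-true)
open import Defs

module _ {Atom : Set} where

  private
    Fm  = Formula Atom
    Seq = Sequent Atom
    Ctx = Context Atom

  ^⊥-involutive : ∀ (A : Fm) → A ^⊥ ^⊥ ≡ A
  ^⊥-involutive (pos α) = refl
  ^⊥-involutive (neg α) = refl
  ^⊥-involutive (A ∧ B) = cong₂ _∧_ (^⊥-involutive A) (^⊥-involutive B)
  ^⊥-involutive (A ∨ B) = cong₂ _∨_ (^⊥-involutive A) (^⊥-involutive B)
  ^⊥-involutive (□ A)   = cong □_ (^⊥-involutive A)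
  ^⊥-involutive (◇ A)   = cong ◇_ (^⊥-involutive A)

  -- Sequents and contexts

  ≡⇒≈ : ∀ {X Y : Seq} → X ≡ Y → X ≈ Y
  ≡⇒≈ refl = ≈-refl

  ▸▸-identityˡ : ∀ (X : Seq) → ∅ ▸▸ X ≡ X
  ▸▸-identityˡ ∅          = refl
  ▸▸-identityˡ (X ▸ A)    = cong (_▸ A) (▸▸-identityˡ X)
  ▸▸-identityˡ (X ▸[ Y ]) = cong (_▸[ Y ]) (▸▸-identityˡ X)

  ▸▸-assoc : ∀ (X Y Z : Seq) → (X ▸▸ Y) ▸▸ Z ≡ X ▸▸ (Y ▸▸ Z)
  ▸▸-assoc X Y ∅          = refl
  ▸▸-assoc X Y (Z ▸ A)    = cong (_▸ A) (▸▸-assoc X Y Z)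
  ▸▸-assoc X Y (Z ▸[ V ]) = cong (_▸[ V ]) (▸▸-assoc X Y Z)

  ▸▸-congʳ : ∀ (X : Seq) {Y Z} → Y ≈ Z → X ▸▸ Y ≈ X ▸▸ Z
  ▸▸-congʳ X ≈-refl         = ≈-refl
  ▸▸-congʳ X (≈-sym e)      = ≈-sym (▸▸-congʳ X e)
  ▸▸-congʳ X (≈-trans e e′) = ≈-trans (▸▸-congʳ X e) (▸▸-congʳ X e′)
  ▸▸-congʳ X (▸-cong e)     = ▸-cong (▸▸-congʳ X e)
  ▸▸-congʳ X (▸[]-cong e e′) = ▸[]-cong (▸▸-congʳ X e) e′
  ▸▸-congʳ X swap-ff        = swap-ff
  ▸▸-congʳ X swap-fb        = swap-fb
  ▸▸-congʳ X swap-bb        = swap-bb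

  ▸-▸▸ : ∀ (X Y : Seq) {A} → X ▸ A ▸▸ Y ≈ (X ▸▸ Y) ▸ A
  ▸-▸▸ X ∅          = ≈-refl
  ▸-▸▸ X (Y ▸ B)    = ≈-trans (▸-cong (▸-▸▸ X Y)) swap-ff
  ▸-▸▸ X (Y ▸[ Z ]) = ≈-trans (▸[]-cong (▸-▸▸ X Y) ≈-refl) swap-fb

  ▸[]-▸▸ : ∀ (X Y : Seq) {V} → X ▸[ V ] ▸▸ Y ≈ (X ▸▸ Y) ▸[ V ]
  ▸[]-▸▸ X ∅          = ≈-refl
  ▸[]-▸▸ X (Y ▸ B)    = ≈-trans (▸-cong (▸[]-▸▸ X Y)) (≈-sym swap-fb)
  ▸[]-▸▸ X (Y ▸[ Z ]) = ≈-trans (▸[]-cong (▸[]-▸▸ X Y) ≈-refl) swap-bb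

  ⟨⟩-cong : ∀ (Γ : Ctx) {X Y} → X ≈ Y → Γ ⟨ X ⟩ ≈ Γ ⟨ Y ⟩
  ⟨⟩-cong (Θ ▸｛-｝)   e = ▸▸-congʳ Θ e
  ⟨⟩-cong (Θ ▸[ Γ ]ᶜ) e = ▸[]-cong ≈-refl (⟨⟩-cong Γ e)

  infixl 12 _∘ᶜ_
  _∘ᶜ_ : Ctx → Ctx → Ctx
  (Θ ▸｛-｝)   ∘ᶜ (X ▸｛-｝)   = (Θ ▸▸ X) ▸｛-｝
  (Θ ▸｛-｝)   ∘ᶜ (X ▸[ Δ ]ᶜ) = (Θ ▸▸ X) ▸[ Δ ]ᶜ
  (Θ ▸[ Γ ]ᶜ) ∘ᶜ Δ          = Θ ▸[ Γ ∘ᶜ Δ ]ᶜ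

  ∘ᶜ-⟨⟩ : ∀ Γ Δ (X : Seq) → (Γ ∘ᶜ Δ) ⟨ X ⟩ ≡ Γ ⟨ Δ ⟨ X ⟩ ⟩
  ∘ᶜ-⟨⟩ (Θ ▸｛-｝)   (Y ▸｛-｝)   X = ▸▸-assoc Θ Y X
  ∘ᶜ-⟨⟩ (Θ ▸｛-｝)   (Y ▸[ Δ ]ᶜ) X = refl
  ∘ᶜ-⟨⟩ (Θ ▸[ Γ ]ᶜ) Δ          X = cong (Θ ▸[_]) (∘ᶜ-⟨⟩ Γ Δ X)

  depth-∘ᶜ : ∀ (Γ Δ : Ctx) → depth Γ > 0 → depth (Γ ∘ᶜ Δ) > 0
  depth-∘ᶜ (Θ ▸[ Γ ]ᶜ) Δ _ = s≤s z≤n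

  formulas : Seq → List Fm
  formulas ∅          = []
  formulas (X ▸ A)    = A ∷ formulas X
  formulas (X ▸[ Y ]) = formulas X

  brackets : Seq → List Seq
  brackets ∅          = []
  brackets (X ▸ A)    = brackets X
  brackets (X ▸[ Y ]) = Y ∷ brackets X

  formulas-▸▸ : ∀ {A} (X Y : Seq) → A ∈ formulas X → A ∈ formulas (X ▸▸ Y)
  formulas-▸▸ X ∅          p = p
  formulas-▸▸ X (Y ▸ B)    p = there (formulas-▸▸ X Y p)
  formulas-▸▸ X (Y ▸[ Z ]) p = formulas-▸▸ X Y p

  extract-formula : ∀ {A} X → A ∈ formulas X → ∃ λ Y → X ≈ Y ▸ A
  extract-formula (X ▸ A) (here refl) = X , ≈-refl
  extract-formula (X ▸ B) (there p) with extract-formula X p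
  ... | Y , e = Y ▸ B , ≈-trans (▸-cong e) swap-ff
  extract-formula (X ▸[ Z ]) p with extract-formula X p
  ... | Y , e = Y ▸[ Z ] , ≈-trans (▸[]-cong e ≈-refl) swap-fb

  extract-formulas : ∀ {A B} X → ¬ A ≡ B → A ∈ formulas X → B ∈ formulas X →
                     ∃ λ Y → X ≈ Y ▸ A ▸ B
  extract-formulas (X ▸ C) A≢B (here refl) (here refl) = ⊥-elim (A≢B refl)
  extract-formulas (X ▸ C) A≢B (here refl) (there q) with extract-formula X q
  ... | Y , e = Y , ≈-trans (▸-cong e) swap-ff
  extract-formulas (X ▸ C) A≢B (there p) (here refl) with extract-formula X p
  ... | Y , e = Y , ▸-cong e
  extract-formulas (X ▸ C) A≢B (there p) (there q) with extract-formulas X A≢B p q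
  ... | Y , e = Y ▸ C , ≈-trans (▸-cong e) (≈-trans swap-ff (▸-cong swap-ff))
  extract-formulas (X ▸[ Z ]) A≢B p q with extract-formulas X A≢B p q
  ... | Y , e = Y ▸[ Z ] , ≈-trans (▸[]-cong e ≈-refl)
                             (≈-trans swap-fb (▸-cong swap-fb))

  -- The equation on `formulas` keeps track of the diamonds beside the bracket, which act inside it.
  extract-bracket : ∀ {Z} X → Z ∈ brackets X →
                    ∃ λ Y → X ≈ Y ▸[ Z ] × formulas Y ≡ formulas X
  extract-bracket (X ▸ A) p with extract-bracket X p
  ... | Y , e , f = Y ▸ A , ≈-trans (▸-cong e) (≈-sym swap-fb) , cong (A ∷_) f
  extract-bracket (X ▸[ V ]) (here refl) = X , ≈-refl , refl
  extract-bracket (X ▸[ V ]) (there p) with extract-bracket X p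
  ... | Y , e , f = Y ▸[ V ] , ≈-trans (▸[]-cong e ≈-refl) swap-bb , f

  -- Finite tree models

  data Model : Set where
    leaf : (Atom → Bool) → Model
    -- M ⊲ N is M with N attached as one more child of the root.
    _⊲_  : Model → Model → Model

  infix 10 _≺_ _⊩_ _⊨_
  -- Worlds are identified with the subtrees rooted at them. Proper descendants at every depth count
  -- as successors, which makes the relation transitive.
  data _≺_ : Model → Model → Set where
    old   : ∀ {K M N} → K ≺ M → K ≺ M ⊲ N
    child : ∀ {M N} → N ≺ M ⊲ N
    below : ∀ {K M N} → K ≺ N → K ≺ M ⊲ N

  ≺-trans : ∀ {K M N} → K ≺ M → M ≺ N → K ≺ N
  ≺-trans p (old q)   = old (≺-trans p q)
  ≺-trans p child     = below p
  ≺-trans p (below q) = below (≺-trans p q)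

  -- The step is demanded only below `M`, because `löb` has its hypothesis only there.
  ≺-induction : ∀ (P : Model → Set) M →
                (∀ {N} → N ≺ M → (∀ {K} → K ≺ N → P K) → P N) → ∀ {N} → N ≺ M → P N
  ≺-induction P (M ⊲ M′) step (old p)   = ≺-induction P M (step ∘ old) p
  ≺-induction P (M ⊲ M′) step child     = step child (≺-induction P M′ (step ∘ below))
  ≺-induction P (M ⊲ M′) step (below p) = ≺-induction P M′ (step ∘ below) p

  ≺-search : ∀ {P Q : Model → Set} → (∀ N → P N ⊎ Q N) →
             ∀ M → (∀ {N} → N ≺ M → P N) ⊎ ∃ λ N → N ≺ M × Q N
  ≺-search d (leaf v) = inj₁ λ ()
  ≺-search d (M ⊲ M′) with ≺-search d M | d M′ | ≺-search d M′
  ... | inj₂ (N , p , q) | _      | _                = inj₂ (N , old p , q)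
  ... | inj₁ _           | inj₂ q | _                = inj₂ (M′ , child , q)
  ... | inj₁ _           | inj₁ _ | inj₂ (N , p , q) = inj₂ (N , below p , q)
  ... | inj₁ f           | inj₁ x | inj₁ g           =
    inj₁ λ { (old p) → f p ; child → x ; (below p) → g p }

  valuation : Model → Atom → Bool
  valuation (leaf v) = v
  valuation (M ⊲ N)  = valuation M

  _⊩_ : Model → Fm → Set
  M ⊩ pos α = valuation M α ≡ true
  M ⊩ neg α = valuation M α ≡ false
  M ⊩ A ∧ B = M ⊩ A × M ⊩ B
  M ⊩ A ∨ B = M ⊩ A ⊎ M ⊩ B
  M ⊩ □ A   = ∀ {N} → N ≺ M → N ⊩ A
  M ⊩ ◇ A   = ∃ λ N → N ≺ M × N ⊩ A

  _⊨_ : Model → Seq → Set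
  M ⊨ ∅        = ⊥
  M ⊨ X ▸ A    = M ⊨ X ⊎ M ⊩ A
  M ⊨ X ▸[ Y ] = M ⊨ X ⊎ (∀ {N} → N ≺ M → N ⊨ Y)

  -- Excluded middle holds constructively: valuations are Boolean, and `≺-search` inspects the
  -- finitely many descendants.
  ⊩-total : ∀ A M → M ⊩ A ⊎ M ⊩ A ^⊥
  ⊩-total (pos α) M with valuation M α
  ... | true  = inj₁ refl
  ... | false = inj₂ refl
  ⊩-total (neg α) M with valuation M α
  ... | true  = inj₂ refl
  ... | false = inj₁ refl
  ⊩-total (A ∧ B) M with ⊩-total A M | ⊩-total B M
  ... | inj₂ a | _      = inj₂ (inj₁ a)
  ... | inj₁ _ | inj₂ b = inj₂ (inj₂ b)
  ... | inj₁ a | inj₁ b = inj₁ (a , b)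
  ⊩-total (A ∨ B) M with ⊩-total A M | ⊩-total B M
  ... | inj₁ a | _      = inj₁ (inj₁ a)
  ... | inj₂ _ | inj₁ b = inj₁ (inj₂ b)
  ... | inj₂ a | inj₂ b = inj₂ (a , b)
  ⊩-total (□ A) M = ≺-search (⊩-total A) M
  ⊩-total (◇ A) M = Sum.swap (≺-search (λ N → Sum.swap (⊩-total A N)) M)

  ⊩-consistent : ∀ A {M} → M ⊩ A → ¬ M ⊩ A ^⊥
  ⊩-consistent (pos α) p q with trans (sym p) q
  ... | ()
  ⊩-consistent (neg α) p q with trans (sym p) q
  ... | ()
  ⊩-consistent (A ∧ B) (a , b) (inj₁ a′) = ⊩-consistent A a a′
  ⊩-consistent (A ∧ B) (a , b) (inj₂ b′) = ⊩-consistent B b b′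
  ⊩-consistent (A ∨ B) (inj₁ a) (a′ , b′) = ⊩-consistent A a a′
  ⊩-consistent (A ∨ B) (inj₂ b) (a′ , b′) = ⊩-consistent B b b′
  ⊩-consistent (□ A) f (N , p , a′) = ⊩-consistent A (f p) a′
  ⊩-consistent (◇ A) (N , p , a) f  = ⊩-consistent A a (f p)

  -- Löb's axiom, by converse well-foundedness: once `A` holds at all descendants of a world,
  -- `◇ (A ^⊥)` fails there, which leaves `A`.
  löb : ∀ A {M} → (∀ {N} → N ≺ M → N ⊩ ◇ (A ^⊥) ⊎ N ⊩ A) → M ⊩ □ A
  löb A {M} f = ≺-induction (_⊩ A) M λ p ih →
    [ (λ (_ , q , a) → ⊥-elim (⊩-consistent A (ih q) a)) , (λ a → a) ]′ (f p)

  -- Soundness of the rules, cut included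

  ⊨-resp-≈ : ∀ {X Y} → X ≈ Y → ∀ {M} → (M ⊨ X → M ⊨ Y) × (M ⊨ Y → M ⊨ X)
  ⊨-resp-≈ ≈-refl = (λ x → x) , (λ x → x)
  ⊨-resp-≈ (≈-sym e) = swap (⊨-resp-≈ e)
  ⊨-resp-≈ (≈-trans e e′) =
    proj₁ (⊨-resp-≈ e′) ∘ proj₁ (⊨-resp-≈ e) , proj₂ (⊨-resp-≈ e) ∘ proj₂ (⊨-resp-≈ e′)
  ⊨-resp-≈ (▸-cong e) = Sum.map₁ (proj₁ (⊨-resp-≈ e)) , Sum.map₁ (proj₂ (⊨-resp-≈ e))
  ⊨-resp-≈ (▸[]-cong e e′) =
      Sum.map (proj₁ (⊨-resp-≈ e)) (λ f p → proj₁ (⊨-resp-≈ e′) (f p))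
    , Sum.map (proj₂ (⊨-resp-≈ e)) (λ f p → proj₂ (⊨-resp-≈ e′) (f p))
  ⊨-resp-≈ swap-ff = exchange , exchange
    where
    exchange : ∀ {P Q R : Set} → (P ⊎ Q) ⊎ R → (P ⊎ R) ⊎ Q
    exchange (inj₁ (inj₁ p)) = inj₁ (inj₁ p)
    exchange (inj₁ (inj₂ q)) = inj₂ q
    exchange (inj₂ r)        = inj₁ (inj₂ r)
  ⊨-resp-≈ swap-fb =
      (λ { (inj₁ (inj₁ x)) → inj₁ (inj₁ x) ; (inj₁ (inj₂ a)) → inj₂ a ; (inj₂ f) → inj₁ (inj₂ f) })
    , (λ { (inj₁ (inj₁ x)) → inj₁ (inj₁ x) ; (inj₁ (inj₂ f)) → inj₂ f ; (inj₂ a) → inj₁ (inj₂ a) })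
  ⊨-resp-≈ swap-bb =
      (λ { (inj₁ (inj₁ x)) → inj₁ (inj₁ x) ; (inj₁ (inj₂ a)) → inj₂ a ; (inj₂ f) → inj₁ (inj₂ f) })
    , (λ { (inj₁ (inj₁ x)) → inj₁ (inj₁ x) ; (inj₁ (inj₂ f)) → inj₂ f ; (inj₂ a) → inj₁ (inj₂ a) })

  ⊨-▸▸⁺ˡ : ∀ {M} X Y → M ⊨ X → M ⊨ X ▸▸ Y
  ⊨-▸▸⁺ˡ X ∅          x = x
  ⊨-▸▸⁺ˡ X (Y ▸ A)    x = inj₁ (⊨-▸▸⁺ˡ X Y x)
  ⊨-▸▸⁺ˡ X (Y ▸[ Z ]) x = inj₁ (⊨-▸▸⁺ˡ X Y x)

  ⊨-▸▸⁺ʳ : ∀ {M} X Y → M ⊨ Y → M ⊨ X ▸▸ Y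
  ⊨-▸▸⁺ʳ X (Y ▸ A)    = Sum.map₁ (⊨-▸▸⁺ʳ X Y)
  ⊨-▸▸⁺ʳ X (Y ▸[ Z ]) = Sum.map₁ (⊨-▸▸⁺ʳ X Y)

  ⊨-▸▸⁻ : ∀ {M} X Y → M ⊨ X ▸▸ Y → M ⊨ X ⊎ M ⊨ Y
  ⊨-▸▸⁻ X ∅          x = inj₁ x
  ⊨-▸▸⁻ X (Y ▸ A)    (inj₁ x) = Sum.map₂ inj₁ (⊨-▸▸⁻ X Y x)
  ⊨-▸▸⁻ X (Y ▸ A)    (inj₂ a) = inj₂ (inj₂ a)
  ⊨-▸▸⁻ X (Y ▸[ Z ]) (inj₁ x) = Sum.map₂ inj₁ (⊨-▸▸⁻ X Y x)
  ⊨-▸▸⁻ X (Y ▸[ Z ]) (inj₂ f) = inj₂ (inj₂ f)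

  ⊨-⟨⟩-valid : ∀ Γ {X} → (∀ {M} → M ⊨ X) → ∀ {M} → M ⊨ Γ ⟨ X ⟩
  ⊨-⟨⟩-valid (Θ ▸｛-｝)   {X} f = ⊨-▸▸⁺ʳ Θ X f
  ⊨-⟨⟩-valid (Θ ▸[ Γ ]ᶜ) f = inj₂ λ _ → ⊨-⟨⟩-valid Γ f

  -- The assumption ranges over all models since the hole may be evaluated at any descendant. Two
  -- inputs serve the two-premise rules `∧` and cut.
  ⊨-⟨⟩-mono₂ : ∀ Γ {X Y Z} → (∀ {M} → M ⊨ X → M ⊨ Y → M ⊨ Z) →
               ∀ {M} → M ⊨ Γ ⟨ X ⟩ → M ⊨ Γ ⟨ Y ⟩ → M ⊨ Γ ⟨ Z ⟩
  ⊨-⟨⟩-mono₂ (Θ ▸｛-｝) {X} {Y} {Z} f p q with ⊨-▸▸⁻ Θ X p | ⊨-▸▸⁻ Θ Y q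
  ... | inj₁ t | _      = ⊨-▸▸⁺ˡ Θ Z t
  ... | inj₂ _ | inj₁ t = ⊨-▸▸⁺ˡ Θ Z t
  ... | inj₂ x | inj₂ y = ⊨-▸▸⁺ʳ Θ Z (f x y)
  ⊨-⟨⟩-mono₂ (Θ ▸[ Γ ]ᶜ) f (inj₁ t) _        = inj₁ t
  ⊨-⟨⟩-mono₂ (Θ ▸[ Γ ]ᶜ) f (inj₂ _) (inj₁ t) = inj₁ t
  ⊨-⟨⟩-mono₂ (Θ ▸[ Γ ]ᶜ) f (inj₂ g) (inj₂ h) = inj₂ λ p → ⊨-⟨⟩-mono₂ Γ f (g p) (h p)

  ⊨-⟨⟩-mono : ∀ Γ {X Y} → (∀ {M} → M ⊨ X → M ⊨ Y) → ∀ {M} → M ⊨ Γ ⟨ X ⟩ → M ⊨ Γ ⟨ Y ⟩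
  ⊨-⟨⟩-mono Γ f p = ⊨-⟨⟩-mono₂ Γ (λ x _ → f x) p p

  ⊨-⟨⟩-delete-root : ∀ Δ {A M} → ¬ M ⊩ A → (∀ {N} → N ≺ M → ¬ N ⊩ A) →
                     M ⊨ Δ ⟨ ∅ ▸ A ⟩ → M ⊨ Δ ⟨ ∅ ⟩
  ⊨-⟨⟩-delete-root (Θ ▸｛-｝)   r b (inj₁ t) = t
  ⊨-⟨⟩-delete-root (Θ ▸｛-｝)   r b (inj₂ a) = ⊥-elim (r a)
  ⊨-⟨⟩-delete-root (Θ ▸[ Δ ]ᶜ) r b (inj₁ t) = inj₁ t
  ⊨-⟨⟩-delete-root (Θ ▸[ Δ ]ᶜ) r b (inj₂ f) =
    inj₂ λ p → ⊨-⟨⟩-delete-root Δ (b p) (λ q → b (≺-trans q p)) (f p)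

  -- At positive depth the hole is evaluated only at proper descendants of `M`, by transitivity, so
  -- `A` may still hold at `M` itself. This is where the side condition of the ◇ rule enters.
  ⊨-⟨⟩-delete : ∀ Δ {A M} → depth Δ > 0 → (∀ {N} → N ≺ M → ¬ N ⊩ A) →
                M ⊨ Δ ⟨ ∅ ▸ A ⟩ → M ⊨ Δ ⟨ ∅ ⟩
  ⊨-⟨⟩-delete (Θ ▸[ Δ ]ᶜ) _ b (inj₁ t) = inj₁ t
  ⊨-⟨⟩-delete (Θ ▸[ Δ ]ᶜ) _ b (inj₂ f) =
    inj₂ λ p → ⊨-⟨⟩-delete-root Δ (b p) (λ q → b (≺-trans q p)) (f p)

  soundness : ∀ {s X} → s ⊢ X → ∀ {M} → M ⊨ X
  soundness (exch e d) = proj₁ (⊨-resp-≈ e) (soundness d)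
  soundness (id Γ α) = ⊨-⟨⟩-valid Γ λ {M} → Sum.map₁ inj₂ (⊩-total (neg α) M)
  soundness (∧-rule Γ A B d e) =
    ⊨-⟨⟩-mono₂ Γ (λ { (inj₂ a) (inj₂ b) → inj₂ (a , b) }) (soundness d) (soundness e)
  soundness (∨-rule Γ A B d) =
    ⊨-⟨⟩-mono Γ (λ { (inj₁ (inj₂ a)) → inj₂ (inj₁ a) ; (inj₂ b) → inj₂ (inj₂ b) }) (soundness d)
  soundness (□-rule Γ A d) = ⊨-⟨⟩-mono Γ reduce (soundness d)
    where
    split : ∀ {N} → N ⊨ ∅ ▸ ◇ (A ^⊥) ▸ A → N ⊩ ◇ (A ^⊥) ⊎ N ⊩ A
    split (inj₁ (inj₂ a)) = inj₁ a
    split (inj₂ a)        = inj₂ a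
    reduce : ∀ {M} → M ⊨ ∅ ▸[ ∅ ▸ ◇ (A ^⊥) ▸ A ] → M ⊨ ∅ ▸ □ A
    reduce {M} (inj₂ f) = inj₂ λ {N} → löb A {M} (λ p → split (f p)) {N}
  soundness (◇-rule Γ Δ A Δ>0 d) = ⊨-⟨⟩-mono Γ reduce (soundness d)
    where
    reduce : ∀ {M} → M ⊨ Δ ⟨ ∅ ▸ A ⟩ ▸ ◇ A → M ⊨ Δ ⟨ ∅ ⟩ ▸ ◇ A
    -- If `◇ A` fails at `M`, then `A` fails at every descendant and can be erased from the hole.
    reduce {M} (inj₁ x) with ⊩-total (◇ A) M
    ... | inj₁ a = inj₂ a
    ... | inj₂ f = inj₁ (⊨-⟨⟩-delete Δ Δ>0 (λ p a → ⊩-consistent A a (f p)) x)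
    reduce (inj₂ a) = inj₂ a
  soundness (cut Γ A d e) =
    ⊨-⟨⟩-mono₂ Γ (λ { (inj₂ a) (inj₂ b) → ⊩-consistent A a b }) (soundness d) (soundness e)

  -- Cut-free provability below given diamonds

  -- Some `◇ A` sits at a proper ancestor of the hole of `Γ`. The decomposition has the shape of the
  -- ◇ rule and holds for all fillings, so that premise and conclusion share it.
  record Above (A : Fm) (Γ : Ctx) : Set where
    constructor above
    field
      outer inner : Ctx
      inner>0     : depth inner > 0
      split       : ∀ X → Γ ⟨ X ⟩ ≈ outer ⟨ inner ⟨ X ⟩ ▸ ◇ A ⟩

  Above-∘ᶜ : ∀ {A Γ} Δ → Above A Γ → Above A (Γ ∘ᶜ Δ)
  Above-∘ᶜ {Γ = Γ} Δ (above O I I>0 split) = above O (I ∘ᶜ Δ) (depth-∘ᶜ I Δ I>0) λ X →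
    ≈-trans (≡⇒≈ (∘ᶜ-⟨⟩ Γ Δ X))
      (≈-trans (split (Δ ⟨ X ⟩)) (⟨⟩-cong O (▸-cong (≡⇒≈ (sym (∘ᶜ-⟨⟩ I Δ X))))))

  -- Quantifying over the surroundings makes the search local: a node knows only the arguments `D`
  -- of diamonds above it.
  Provable : List Fm → Seq → Set
  Provable D X = ∀ Γ → (∀ {A} → A ∈ D → Above A Γ) → cut-free ⊢ Γ ⟨ X ⟩

  module _ {D : List Fm} where

    Provable-≈ : ∀ {X Y} → X ≈ Y → Provable D X → Provable D Y
    Provable-≈ e p Γ d = exch (⟨⟩-cong Γ e) (p Γ d)

    private
      fill : ∀ Γ X Y → cut-free ⊢ (Γ ∘ᶜ (X ▸｛-｝)) ⟨ Y ⟩ → cut-free ⊢ Γ ⟨ X ▸▸ Y ⟩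
      fill Γ X Y = subst (cut-free ⊢_) (∘ᶜ-⟨⟩ Γ (X ▸｛-｝) Y)

      unfill : ∀ Γ X Y → cut-free ⊢ Γ ⟨ X ▸▸ Y ⟩ → cut-free ⊢ (Γ ∘ᶜ (X ▸｛-｝)) ⟨ Y ⟩
      unfill Γ X Y = subst (cut-free ⊢_) (sym (∘ᶜ-⟨⟩ Γ (X ▸｛-｝) Y))

    Provable-id : ∀ {X α} → Provable D (X ▸ neg α ▸ pos α)
    Provable-id {X} {α} Γ d = fill Γ X (∅ ▸ neg α ▸ pos α) (id (Γ ∘ᶜ (X ▸｛-｝)) α)

    Provable-∧ : ∀ {X A B} → Provable D (X ▸ A) → Provable D (X ▸ B) → Provable D (X ▸ A ∧ B)
    Provable-∧ {X} {A} {B} p q Γ d =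
      fill Γ X (∅ ▸ A ∧ B) (∧-rule (Γ ∘ᶜ (X ▸｛-｝)) A B (unfill Γ X (∅ ▸ A) (p Γ d)) (unfill Γ X (∅ ▸ B) (q Γ d)))

    Provable-∨ : ∀ {X A B} → Provable D (X ▸ A ▸ B) → Provable D (X ▸ A ∨ B)
    Provable-∨ {X} {A} {B} p Γ d =
      fill Γ X (∅ ▸ A ∨ B) (∨-rule (Γ ∘ᶜ (X ▸｛-｝)) A B (unfill Γ X (∅ ▸ A ▸ B) (p Γ d)))

    Provable-□ : ∀ {X A} → Provable D (X ▸[ ∅ ▸ ◇ (A ^⊥) ▸ A ]) → Provable D (X ▸ □ A)
    Provable-□ {X} {A} p Γ d =
      fill Γ X (∅ ▸ □ A) (□-rule (Γ ∘ᶜ (X ▸｛-｝)) A (unfill Γ X (∅ ▸[ ∅ ▸ ◇ (A ^⊥) ▸ A ]) (p Γ d)))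

    Provable-◇ : ∀ {X A} → A ∈ D → Provable D (X ▸ A) → Provable D X
    Provable-◇ {X} {A} A∈D p Γ d with Above-∘ᶜ (X ▸｛-｝) (d A∈D)
    ... | above O I I>0 split =
      fill Γ X ∅ (exch (≈-sym (split ∅))
        (◇-rule O I A I>0 (exch (split (∅ ▸ A)) (unfill Γ X (∅ ▸ A) (p Γ d)))))

    -- Inside a bracket, the diamonds of the enclosing node join those above it.
    Provable-bracket : ∀ {D′ X Y} → (∀ {A} → A ∈ D′ → ◇ A ∈ formulas X ⊎ A ∈ D) →
                       Provable D′ Y → Provable D (X ▸[ Y ])
    Provable-bracket {D′} {X} {Y} D′⊆ p Γ d =
      subst (cut-free ⊢_)
        (trans (∘ᶜ-⟨⟩ Γ hole Y) (cong (λ Z → Γ ⟨ X ▸[ Z ] ⟩) (▸▸-identityˡ Y)))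
        (p (Γ ∘ᶜ hole) (λ A∈D′ → [ at-node , (λ A∈D → Above-∘ᶜ hole (d A∈D)) ]′ (D′⊆ A∈D′)))
      where
      hole : Ctx
      hole = X ▸[ ∅ ▸｛-｝ ]ᶜ
      at-node : ∀ {A} → ◇ A ∈ formulas X → Above A (Γ ∘ᶜ hole)
      at-node ◇A∈X with extract-formula X ◇A∈X
      ... | X′ , e = above Γ (X′ ▸[ ∅ ▸｛-｝ ]ᶜ) (s≤s z≤n) λ Z →
        ≈-trans (≡⇒≈ (∘ᶜ-⟨⟩ Γ hole Z))
          (⟨⟩-cong Γ (≈-trans (▸[]-cong e ≈-refl) swap-fb))

  -- Derivability of dual pairs

  Provable-∨-∧ : ∀ {D X A A′ B B′} → (∀ {X} → Provable D (X ▸ A ▸ A′)) →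
                 (∀ {X} → Provable D (X ▸ B ▸ B′)) → Provable D (X ▸ A ∨ B ▸ A′ ∧ B′)
  Provable-∨-∧ p q = Provable-≈ swap-ff (Provable-∨ (Provable-≈ rotate
    (Provable-∧ (Provable-≈ (▸-cong swap-ff) p) q)))
    where
    rotate : ∀ {X : Seq} {A B C} → X ▸ A ▸ B ▸ C ≈ X ▸ C ▸ A ▸ B
    rotate = ≈-trans swap-ff (▸-cong swap-ff)

  -- After the □ rule, the available `◇ A′` puts `A′` beside `A` in the new bracket. With `A′` the
  -- dual of `A`, this closes any branch on which `□ A` would be expanded again. Keeping `A′`
  -- arbitrary lets both modal cases of `Provable-dual` use it.
  Provable-Löb : ∀ {D X A A′} → (∀ {D X} → Provable D (X ▸ A ▸ A′)) →
                 ◇ A′ ∈ formulas X ⊎ A′ ∈ D → Provable D (X ▸ □ A)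
  Provable-Löb {A′ = A′} p m = Provable-□ (Provable-bracket {D′ = [ A′ ]}
    (λ { (here refl) → m }) (Provable-◇ (here refl) p))

  Provable-dual : ∀ A {D X} → Provable D (X ▸ A ▸ A ^⊥)
  Provable-dual (pos α) = Provable-≈ swap-ff Provable-id
  Provable-dual (neg α) = Provable-id
  Provable-dual (A ∧ B) = Provable-≈ swap-ff (Provable-∨-∧
    (Provable-≈ swap-ff (Provable-dual A)) (Provable-≈ swap-ff (Provable-dual B)))
  Provable-dual (A ∨ B) = Provable-∨-∧ (Provable-dual A) (Provable-dual B)
  Provable-dual (□ A) = Provable-≈ swap-ff (Provable-Löb (Provable-dual A) (inj₁ (here refl)))
  Provable-dual (◇ A) = Provable-Löb (Provable-≈ swap-ff (Provable-dual A)) (inj₁ (here refl))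

  -- Countermodels

  Countermodel : List Fm → Seq → Set
  Countermodel D X = ∃ λ M → ¬ M ⊨ X × (∀ {A N} → A ∈ D → N ≺ M → ¬ N ⊩ A)

  -- Refuting `D` at the root as well is what allows the model to be attached as a child: its root
  -- then becomes a proper descendant.
  Countermodel⁺ : List Fm → Seq → Set
  Countermodel⁺ D X =
    ∃ λ M → ¬ M ⊨ X × (∀ {A} → A ∈ D → ¬ M ⊩ A) × (∀ {A N} → A ∈ D → N ≺ M → ¬ N ⊩ A)

  Result Result⁺ : List Fm → Seq → Set
  Result  D X = Provable D X ⊎ Countermodel D X
  Result⁺ D X = Provable D X ⊎ Countermodel⁺ D X

  -- The second function is semantic invertibility: a countermodel of the premise refutes the
  -- conclusion.
  Result-map : ∀ {D X Y} → (Provable D X → Provable D Y) → (∀ {M} → M ⊨ Y → M ⊨ X) →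
               Result D X → Result D Y
  Result-map f g = Sum.map f λ (M , r , b) → M , r ∘ g , b

  Result-≈ : ∀ {D X Y} → X ≈ Y → Result D X → Result D Y
  Result-≈ e = Result-map (Provable-≈ e) (proj₂ (⊨-resp-≈ e))

  Result-∧ : ∀ {D X A B} → Result D (X ▸ A) → Result D (X ▸ B) → Result D (X ▸ A ∧ B)
  Result-∧ (inj₁ p) (inj₁ q) = inj₁ (Provable-∧ p q)
  Result-∧ (inj₁ _) (inj₂ (M , r , b)) = inj₂ (M , r ∘ Sum.map₂ proj₂ , b)
  Result-∧ (inj₂ (M , r , b)) _        = inj₂ (M , r ∘ Sum.map₂ proj₁ , b)

  Result-∨ : ∀ {D X A B} → Result D (X ▸ A ▸ B) → Result D (X ▸ A ∨ B)
  Result-∨ = Result-map Provable-∨ λ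
    { (inj₁ x) → inj₁ (inj₁ x) ; (inj₂ (inj₁ a)) → inj₁ (inj₂ a) ; (inj₂ (inj₂ b)) → inj₂ b }

  Result-□ : ∀ {D X A} → Result D (X ▸[ ∅ ▸ ◇ (A ^⊥) ▸ A ]) → Result D (X ▸ □ A)
  Result-□ = Result-map Provable-□ (Sum.map₂ λ f p → inj₂ (f p))

  fromFormulas : List Fm → Seq
  fromFormulas []       = ∅
  fromFormulas (A ∷ As) = fromFormulas As ▸ A

  ⊨-fromFormulas : ∀ {A M} As → A ∈ As → M ⊩ A → M ⊨ fromFormulas As
  ⊨-fromFormulas (A ∷ As) (here refl) a = inj₂ a
  ⊨-fromFormulas (A ∷ As) (there p)   a = inj₁ (⊨-fromFormulas As p a)

  Provable-◇s : ∀ {D} As {X} → As ⊆ D → Provable D (X ▸▸ fromFormulas As) → Provable D X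
  Provable-◇s []       As⊆D p = p
  Provable-◇s (A ∷ As) As⊆D p = Provable-◇s As (As⊆D ∘ there) (Provable-◇ (As⊆D (here refl)) p)

  -- Each diamond above lets its argument be added to the node. Refuting the enlarged sequent then
  -- refutes `D` at the root, which upgrades the countermodel.
  Result-◇s : ∀ {D X} → Result D (X ▸▸ fromFormulas D) → Result⁺ D X
  Result-◇s {D} (inj₁ p) = inj₁ (Provable-◇s D (λ x → x) p)
  Result-◇s {D} {X} (inj₂ (M , r , b)) = inj₂ (M , r ∘ ⊨-▸▸⁺ˡ X (fromFormulas D) ,
    (λ A∈D a → r (⊨-▸▸⁺ʳ X (fromFormulas D) (⊨-fromFormulas D A∈D a))) , b)

  diamond : Fm → List Fm
  diamond (◇ A) = [ A ]
  diamond _     = []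

  diamonds : Seq → List Fm
  diamonds X = concatMap diamond (formulas X)

  ∈-diamonds⁺ : ∀ {A} X → ◇ A ∈ formulas X → A ∈ diamonds X
  ∈-diamonds⁺ X p = ∈-concatMap⁺ diamond (Any.map (λ { refl → here refl }) p)

  ∈-diamonds⁻ : ∀ {A} X → A ∈ diamonds X → ◇ A ∈ formulas X
  ∈-diamonds⁻ X p = Any.map (λ {B} → ∈-diamond⁻ B) (∈-concatMap⁻ diamond {xs = formulas X} p)
    where
    ∈-diamond⁻ : ∀ {A} B → A ∈ diamond B → ◇ A ≡ B
    ∈-diamond⁻ (◇ A) (here refl) = refl

  ¬⊨-intro : ∀ {M} X → (∀ {A} → A ∈ formulas X → ¬ M ⊩ A) →
             All (λ Y → ∃ λ N → N ≺ M × ¬ N ⊨ Y) (brackets X) → ¬ M ⊨ X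
  ¬⊨-intro (X ▸ A)    f b (inj₁ x) = ¬⊨-intro X (f ∘ there) b x
  ¬⊨-intro (X ▸ A)    f b (inj₂ a) = f (here refl) a
  ¬⊨-intro (X ▸[ Y ]) f (_ ∷ b) (inj₁ x) = ¬⊨-intro X f b x
  ¬⊨-intro (X ▸[ Y ]) f ((N , p , r) ∷ b) (inj₂ g) = r (g p)

  -- The countermodels become the children of a fresh root valued by `v`. Each refutes `D`
  -- throughout, its root included, so all descendants of the new root do.
  assemble : ∀ {D} (v : Atom → Bool) {Ys} → All (Countermodel⁺ D) Ys →
             ∃ λ M → valuation M ≡ v × All (λ Y → ∃ λ N → N ≺ M × ¬ N ⊨ Y) Ys ×
                     (∀ {A N} → A ∈ D → N ≺ M → ¬ N ⊩ A)
  assemble v [] = leaf v , refl , [] , λ _ ()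
  assemble v ((N , r , n , b) ∷ cs) with assemble v cs
  ... | M , eq , rs , bs = M ⊲ N , eq
    , (N , child , r) ∷ All.map (λ (K , p , k) → K , old p , k) rs
    , λ { A∈D (old p) → bs A∈D p ; A∈D child → n A∈D ; A∈D (below p) → b A∈D p }

  -- The search procedure

  -- The C such that □ C may arise in a search from A.  As ◇ A comes from
  -- expanding □ (A ^⊥), this list is made invariant under A ↦ A ^⊥.
  boxes : Fm → List Fm
  boxes (pos α) = []
  boxes (neg α) = []
  boxes (A ∧ B) = boxes A ++ boxes B
  boxes (A ∨ B) = boxes A ++ boxes B
  boxes (□ A)   = A ∷ boxes A
  boxes (◇ A)   = A ^⊥ ∷ boxes A

  boxes-^⊥ : ∀ A → boxes (A ^⊥) ≡ boxes A
  boxes-^⊥ (pos α) = refl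
  boxes-^⊥ (neg α) = refl
  boxes-^⊥ (A ∧ B) = cong₂ _++_ (boxes-^⊥ A) (boxes-^⊥ B)
  boxes-^⊥ (A ∨ B) = cong₂ _++_ (boxes-^⊥ A) (boxes-^⊥ B)
  boxes-^⊥ (□ A)   = cong₂ _∷_ (^⊥-involutive A) (boxes-^⊥ A)
  boxes-^⊥ (◇ A)   = cong (A ^⊥ ∷_) (boxes-^⊥ A)

  boxesˢ : Seq → List Fm
  boxesˢ ∅          = []
  boxesˢ (X ▸ A)    = boxes A ++ boxesˢ X
  boxesˢ (X ▸[ Y ]) = boxesˢ Y ++ boxesˢ X

  -- U lists the boxes that may still be expanded, F diamonds present at or above
  -- the current node.
  Covered : (U F Cs : List Fm) → Set
  Covered U F = All λ C → C ∈ U ⊎ C ^⊥ ∈ F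

  Covered-mono : ∀ {U F F′ Cs} → F ⊆ F′ → Covered U F Cs → Covered U F′ Cs
  Covered-mono F⊆F′ = All.map (Sum.map₂ F⊆F′)

  -- The drop in length gives termination; further copies of `B` may remain in `U′`.
  remove : ∀ {B : Fm} {U} → B ∈ U →
           ∃ λ U′ → length U ≡ suc (length U′) × (∀ {C} → C ∈ U → C ≡ B ⊎ C ∈ U′)
  remove {U = _ ∷ U} (here refl) =
    U , refl , λ { (here refl) → inj₁ refl ; (there p) → inj₂ p }
  remove {U = A ∷ U} (there p) with remove p
  ... | U′ , eq , f = A ∷ U′ , cong suc eq ,
    λ { (here refl) → inj₂ (here refl) ; (there q) → Sum.map₂ there (f q) }

  -- Expanding `□ B` uses up `B` but leaves `◇ (B ^⊥)` behind, so `B` stays covered, now by the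
  -- second alternative.
  Covered-remove : ∀ {B U U′ D Cs} → (∀ {C} → C ∈ U → C ≡ B ⊎ C ∈ U′) →
                   Covered U D Cs → Covered U′ (B ^⊥ ∷ D) Cs
  Covered-remove f = All.map λ
    { (inj₁ p) → [ (λ { refl → inj₂ (here refl) }) , inj₁ ]′ (f p) ; (inj₂ p) → inj₂ (there p) }

  Solvable : (U F : List Fm) → Seq → Set
  Solvable U F X = ∀ {D} → F ⊆ D → All (Covered U D ∘ boxes) D → Result⁺ D X

  data Simple (U F : List Fm) : Fm → Set where
    pos : ∀ {α} → Simple U F (pos α)
    neg : ∀ {α} → Simple U F (neg α)
    ◇_  : ∀ {A} → Covered U F (boxes A) → Simple U F (◇ A)

  -- The brackets of a saturated node are solved only once all its diamonds are known.
  record Saturated (U F D : List Fm) (Θ : Seq) : Set where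
    constructor saturated
    field
      simple   : All (Simple U F) (formulas Θ)
      solvable : All (Solvable U F) (brackets Θ)
      covers   : ∀ {A} → A ∈ F → ◇ A ∈ formulas Θ ⊎ A ∈ D

  add-formula : ∀ {U F D Θ A} → Simple U F A → Saturated U F D Θ → Saturated U F D (Θ ▸ A)
  add-formula s (saturated ss ks c) = saturated (s ∷ ss) ks (Sum.map₁ there ∘ c)

  add-bracket : ∀ {U F D Θ Y} → Solvable U F Y → Saturated U F D Θ → Saturated U F D (Θ ▸[ Y ])
  add-bracket k (saturated ss ks c) = saturated ss (k ∷ ks) c

  choose : ∀ {A : Set} {P Q : A → Set} {xs} → All (λ x → P x ⊎ Q x) xs →
           (∃ λ x → x ∈ xs × P x) ⊎ All Q xs
  choose [] = inj₂ []
  choose (inj₁ p ∷ _) = inj₁ (_ , here refl , p)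
  choose (inj₂ q ∷ r) with choose r
  ... | inj₁ (x , x∈ , p) = inj₁ (x , there x∈ , p)
  ... | inj₂ qs = inj₂ (q ∷ qs)

  -- Search over atoms with decidable equality

  module Search (_≟_ : DecidableEquality Atom) where

    neg? : ∀ α (B : Fm) → Dec (neg α ≡ B)
    neg? α (neg β) = map′ (cong neg) (λ { refl → refl }) (α ≟ β)
    neg? α (pos β) = no λ ()
    neg? α (A ∧ B) = no λ ()
    neg? α (A ∨ B) = no λ ()
    neg? α (□ A)   = no λ ()
    neg? α (◇ A)   = no λ ()

    neg∈? : ∀ (As : List Fm) α → Dec (neg α ∈ As)
    neg∈? As α = Any.any? (neg? α) As

    Clash : List Fm → Fm → Set
    Clash As A = ∃ λ α → pos α ≡ A × neg α ∈ As

    clash? : ∀ As A → Clash As A ⊎ ¬ Clash As A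
    clash? As (pos α) with neg∈? As α
    ... | yes p = inj₁ (α , refl , p)
    ... | no ¬p = inj₂ λ { (_ , refl , p) → ¬p p }
    clash? As (neg β) = inj₂ λ ()
    clash? As (A ∧ B) = inj₂ λ ()
    clash? As (A ∨ B) = inj₂ λ ()
    clash? As (□ A)   = inj₂ λ ()
    clash? As (◇ A)   = inj₂ λ ()

    -- A provable bracket or a clash of dual atoms yields a derivation. Otherwise the countermodels
    -- of the brackets, assembled under a new root, refute the node.
    solve-saturated : ∀ {U F D Θ} → All (Covered U F ∘ boxes) D → Saturated U F D Θ → Result D Θ
    solve-saturated {U} {F} {D} {Θ} known (saturated simple solvable covers) =
      conclude (choose (All.map (λ k → k F⊆D′ known′) solvable))
               (choose (All.tabulate {xs = formulas Θ} λ {A} _ → clash? (formulas Θ) A))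
      where
      -- The diamonds acting inside the brackets: those of this node and those above.
      D′ : List Fm
      D′ = diamonds Θ ++ D

      F⊆D′ : F ⊆ D′
      F⊆D′ A∈F = [ ∈-++⁺ˡ ∘ ∈-diamonds⁺ Θ , ∈-++⁺ʳ (diamonds Θ) ]′ (covers A∈F)

      D′⊆ : ∀ {A} → A ∈ D′ → ◇ A ∈ formulas Θ ⊎ A ∈ D
      D′⊆ A∈D′ = Sum.map₁ (∈-diamonds⁻ Θ) (∈-++⁻ (diamonds Θ) A∈D′)

      argument : ∀ {A} → Simple U F (◇ A) → Covered U F (boxes A)
      argument (◇ c) = c

      known′ : All (Covered U D′ ∘ boxes) D′
      known′ = All.tabulate λ A∈D′ → Covered-mono F⊆D′
        ([ argument ∘ All.lookup simple , All.lookup known ]′ (D′⊆ A∈D′))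

      v : Atom → Bool
      -- Making `α` true exactly when `neg α` occurs refutes every negative atom; without a clash,
      -- the positive ones fail too.
      v α = does (neg∈? (formulas Θ) α)

      conclude : (∃ λ Y → Y ∈ brackets Θ × Provable D′ Y) ⊎ All (Countermodel⁺ D′) (brackets Θ) →
                 (∃ λ A → A ∈ formulas Θ × Clash (formulas Θ) A) ⊎
                   All (¬_ ∘ Clash (formulas Θ)) (formulas Θ) →
                 Result D Θ
      conclude (inj₁ (Y , Y∈Θ , p)) _ with extract-bracket Θ Y∈Θ
      ... | Θ′ , e , f = inj₁ (Provable-≈ (≈-sym e) (Provable-bracket
        (λ A∈D′ → Sum.map₁ (subst (_ ∈_) (sym f)) (D′⊆ A∈D′)) p))
      conclude (inj₂ _) (inj₁ (_ , pos∈ , α , refl , neg∈))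
        with extract-formulas Θ (λ ()) neg∈ pos∈
      ... | Θ′ , e = inj₁ (Provable-≈ (≈-sym e) Provable-id)
      conclude (inj₂ cs) (inj₂ noClash) with assemble v cs
      ... | M , val , rs , bs =
        inj₂ (M , ¬⊨-intro Θ (λ A∈Θ → refute A∈Θ (All.lookup simple A∈Θ)) rs
                , λ A∈D → bs (∈-++⁺ʳ (diamonds Θ) A∈D))
        where
        refute : ∀ {A} → A ∈ formulas Θ → Simple U F A → ¬ M ⊩ A
        refute {pos α} p pos eq with neg∈? (formulas Θ) α | cong (λ w → w α) val
        ... | yes q | _  = All.lookup noClash p (α , refl , q)
        ... | no _  | v≡ with trans (sym eq) v≡
        ...   | ()
        refute {neg α} p neg eq
          with trans (sym eq) (trans (cong (λ w → w α) val) (dec-true (neg∈? (formulas Θ) α) p))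
        ... | ()
        refute {◇ A} p (◇ _) (N , q , a) = bs (∈-++⁺ˡ (∈-diamonds⁺ Θ p)) q a

    -- `solve-box` stands for the search inside a freshly expanded box; everything in this module
    -- recurs on syntax only.
    module Expand (U : List Fm)
      (solve-box : ∀ {F B} → B ∈ U → Covered U F (boxes B) → Solvable U F (∅ ▸ ◇ (B ^⊥) ▸ B)) where

      -- Continuation-passing: `Δ` waits while `A` is decomposed into the saturated part `Θ`, and
      -- `k` finishes the node for whichever `Θ′` results. Recursion is on `A`, and the two branches
      -- of `∧` call `k` separately.
      solve-formula : ∀ A {F D Θ} Δ → Covered U F (boxes A) → Saturated U F D Θ →
                      (∀ {Θ′} → Saturated U F D Θ′ → Result D (Θ′ ▸▸ Δ)) →
                      Result D (Θ ▸▸ Δ ▸ A)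
      solve-formula (pos α) Δ c s k = Result-≈ (▸-▸▸ _ Δ) (k (add-formula pos s))
      solve-formula (neg α) Δ c s k = Result-≈ (▸-▸▸ _ Δ) (k (add-formula neg s))
      solve-formula (A ∧ B) Δ c s k =
        Result-∧ (solve-formula A Δ (++⁻ˡ (boxes A) c) s k)
                 (solve-formula B Δ (++⁻ʳ (boxes A) c) s k)
      solve-formula (A ∨ B) Δ c s k =
        -- `A` joins the waiting part while `B` is decomposed.
        Result-∨ (solve-formula B (Δ ▸ A) (++⁻ʳ (boxes A) c) s λ s′ →
                  solve-formula A Δ (++⁻ˡ (boxes A) c) s′ k)
      solve-formula (□ B) Δ (inj₁ B∈U ∷ c) s k =
        Result-□ (Result-≈ (▸[]-▸▸ _ Δ) (k (add-bracket (solve-box B∈U c) s)))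
      -- Here `◇ (B ^⊥)` is already at or above the node, so no further expansion is tried.
      solve-formula (□ B) {Θ = Θ} Δ (inj₂ B∈F ∷ c) s k =
        inj₁ (Provable-Löb (Provable-dual B)
          (Sum.map₁ (formulas-▸▸ Θ Δ) (Saturated.covers s B∈F)))
      solve-formula (◇ A) Δ (_ ∷ c) s k = Result-≈ (▸-▸▸ _ Δ) (k (add-formula (◇ c) s))

      solve-formulas : ∀ As {F D Θ} Δ → All (Covered U F ∘ boxes) As → Saturated U F D Θ →
                       (∀ {Θ′} → Saturated U F D Θ′ → Result D (Θ′ ▸▸ Δ)) →
                       Result D (Θ ▸▸ (Δ ▸▸ fromFormulas As))
      solve-formulas []       Δ []       s k = k s
      solve-formulas (A ∷ As) Δ (c ∷ cs) s k =
        solve-formula A (Δ ▸▸ fromFormulas As) c s λ s′ → solve-formulas As Δ cs s′ k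

      mutual
        solve-node : ∀ Δ {F D Θ} → All (Covered U F ∘ boxes) D → Covered U F (boxesˢ Δ) →
                     Saturated U F D Θ → Result⁺ D (Θ ▸▸ Δ)
        solve-node Δ {D = D} {Θ} known c s =
          Result-◇s (subst (Result D) (sym (▸▸-assoc Θ Δ (fromFormulas D)))
            (solve-formulas D Δ known s (solve-items Δ known c)))

        solve-items : ∀ Δ {F D Θ} → All (Covered U F ∘ boxes) D → Covered U F (boxesˢ Δ) →
                      Saturated U F D Θ → Result D (Θ ▸▸ Δ)
        solve-items ∅ known c s = solve-saturated known s
        solve-items (Δ ▸ A) known c s =
          solve-formula A Δ (++⁻ˡ (boxes A) c) s (solve-items Δ known (++⁻ʳ (boxes A) c))
        solve-items (Δ ▸[ Y ]) known c s =
          Result-≈ (▸[]-▸▸ _ Δ) (solve-items Δ known (++⁻ʳ (boxesˢ Y) c)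
            (add-bracket (solve-bracket Y (++⁻ˡ (boxesˢ Y) c)) s))

        solve-bracket : ∀ Y {F} → Covered U F (boxesˢ Y) → Solvable U F Y
        solve-bracket Y c {D} F⊆D known =
          subst (Result⁺ D) (▸▸-identityˡ Y)
            -- The empty saturated part has no diamond of its own, so all of `D` counts as lying
            -- above.
            (solve-node Y known (Covered-mono F⊆D c) (saturated [] [] inj₂))

    solve : ∀ n U → length U ≡ n → ∀ Y {F} → Covered U F (boxesˢ Y) → Solvable U F Y
    -- Recursion is on `n`, the number of entries left in `U`; each expansion removes one.
    solve-box : ∀ n U → length U ≡ n → ∀ {F B} → B ∈ U → Covered U F (boxes B) →
                Solvable U F (∅ ▸ ◇ (B ^⊥) ▸ B)

    solve n U eq = Expand.solve-bracket U (solve-box n U eq)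

    solve-box zero    []      refl ()
    solve-box (suc n) U eq {B = B} B∈U c {D} F⊆D known with remove B∈U
    ... | U′ , eq′ , f =
      -- The new node starts with `◇ (B ^⊥)` already saturated and `B` pending, so `B ^⊥` may join
      -- the known diamonds.
      Expand.solve-node U′ (solve-box n U′ (suc-injective (trans (sym eq′) eq))) (∅ ▸ B)
        (All.map (Covered-remove f) known)
        (subst (Covered U′ (B ^⊥ ∷ D)) (sym (++-identityʳ (boxes B))) cB)
        (saturated ((◇ subst (Covered U′ (B ^⊥ ∷ D)) (sym (boxes-^⊥ B)) cB) ∷ []) []
          λ { (here refl) → inj₁ (here refl) ; (there p) → inj₂ p })
      where
      cB : Covered U′ (B ^⊥ ∷ D) (boxes B)
      cB = Covered-remove f (Covered-mono F⊆D c)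

    decide : ∀ X → Result⁺ [] X
    decide X = solve _ (boxesˢ X) refl X (All.tabulate inj₁) {D = []} (λ p → p) []

  -- Admissibility of cut

  Provable⇒⊢ : ∀ {X} → Provable [] X → cut-free ⊢ X
  Provable⇒⊢ {X} p = subst (cut-free ⊢_) (▸▸-identityˡ X) (p (∅ ▸｛-｝) λ ())

mainTheorem12 : {Atom : Set} → Atom ↣ ℕ → (Γ : Sequent Atom) → with-cut ⊢ Γ → cut-free ⊢ Γ
-- The injection into `ℕ` makes equality of atoms decidable, as the clash test requires.
mainTheorem12 inj Γ d with Search.decide (eq? inj) Γ
... | inj₁ p           = Provable⇒⊢ p
... | inj₂ (M , r , _) = ⊥-elim (r (soundness d))
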